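{- Let $A$ be a commutative ring, $k\ge1$, $\vec s=(n_1,\dots,n_k)$ a tuple of positive integers, $n=\min(n_1,\dots,n_k)-1$, and $X_\bullet=X_\bullet(\vec s;A)$ the diagonal simplicial tensor module. For $p\ge1$ and $0\le j\le p$, the rank of the $A$-module $R_{p,j}(X)=\bigcap_{i\in[p]\setminus\{j\}}\ker(d_i^p:X_p\to X_{p-1})$ is $$\operatorname{rank}R_{p,j}=\sum_{t=0}^{p}(-1)^t\binom pt\prod_{a=1}^k\bigl(M_a(p)+1-t\bigr),$$ where $M_a(p)=n_a-1-n+p$.
   Context: Notation: $[p]=\{0,\dots,p\}$. For a shape $\vec s=(n_1,\dots,n_k)$ of positive integers with $n=\min(n_1,\dots,n_k)-1$, put $M_a(p)=n_a-1-n+p$ (so $M_a(p)\ge p$) and $I_p=\prod_{a=1}^k[M_a(p)]$ for $p\ge 0$. Let $\delta_i^q:[q-1]\to[q]$ be the increasing injection missing $i$, and $\Delta_i^p=\prod_{a=1}^k\delta_i^{M_a(p)}:I_{p-1}\to I_p$ ($p\ge1$, $0\le i\le p$). The diagonal simplicial tensor module $X_\bullet(\vec s;A)$ has $X_p=A^{I_p}$ (all functions $T:I_p\to A$) and faces $d_i^p(T)=T\circ\Delta_i^p$; its degeneracies are $s_i^p(T)=T\circ\Sigma_i^p$ with $\Sigma_i^p=\prod_{a=1}^k\sigma_i^{M_a(p)}:I_{p+1}\to I_p$ ($p\ge0$, $0\le i\le p$), where $\sigma_i^q:[q+1]\to[q]$ is the nondecreasing surjection taking the value $i$ twice. The module $R_{p,j}(X)$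 is a free $A$-module. -}

module Defs where

open import Algebra.Bundles using (CommutativeRing; AbelianGroup)
open import Algebra.Module.Bundles using (Module)
open import Algebra.Module.Bundles.Raw using (RawModule)
open import Algebra.Module.Morphism.Structures using (IsModuleHomomorphism; IsModuleMonomorphism)
open import Algebra.Module.Structures.Biased using (IsModuleFromLeft)
import Algebra.Construct.Pointwise as Pointwise
import Algebra.Module.Morphism.ModuleMonomorphism as ModuleMonomorphism
import Algebra.Properties.CommutativeMonoid.Sum as Sum
open import Data.Fin.Base using (Fin; punchIn; pinch; _↑ˡ_)
open import Data.Nat.Base using (ℕ; suc; pred; _+_; _∸_; _⊓_; NonZero)
open import Data.Product.Base using (Σ; ∃; _,_; proj₁; proj₂)
open import Data.Vec.Base using (Vec; foldr₁)
open import Data.Vec.Functional using (Vector)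
open import Data.Vec.Relation.Unary.All as All using (All)
open import Function.Base using (id; _∘_)
open import Level using (_⊔_)
open import Relation.Binary.PropositionalEquality.Core using (_≢_)

module _ {a ℓa m ℓm} {A : CommutativeRing a ℓa} (M : Module A m ℓm) where
  open CommutativeRing A using (Carrier; _≈_; 0#)
  open Module M
  open Sum +ᴹ-commutativeMonoid using (sum)

  linearCombination : ∀ {r} → Vector Carrier r → Vector Carrierᴹ r → Carrierᴹ
  linearCombination x b = sum (λ i → x i *ₗ b i)

  record IsBasis {r} (b : Vector Carrierᴹ r) : Set (a ⊔ ℓa ⊔ m ⊔ ℓm) where
    field
      linearlyIndependent : ∀ x → linearCombination x b ≈ᴹ 0ᴹ → ∀ i → x i ≈ 0#
      spanning            : ∀ v → ∃ λ x → v ≈ᴹ linearCombination x b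

  -- M is free of rank r.  Over a nontrivial A such an r is unique; over the
  -- trivial ring every module has every finite rank.
  HasRank : ℕ → Set (a ⊔ ℓa ⊔ m ⊔ ℓm)
  HasRank r = ∃ λ (b : Vector Carrierᴹ r) → IsBasis b

module _ {a ℓa m ℓm n ℓn ι} {A : CommutativeRing a ℓa}
  (M : Module A m ℓm) {I : Set ι} (N : I → Module A n ℓn)
  (f : ∀ (j : I) → Module.Carrierᴹ M → Module.Carrierᴹ (N j))
  (f-homo : ∀ (j : I) → IsModuleHomomorphism (Module.rawModule M) (Module.rawModule (N j)) (f j))
  where

  private
    open module M = Module M using (Carrierᴹ; _≈ᴹ_; _+ᴹ_; _*ₗ_; _*ᵣ_; 0ᴹ; -ᴹ_)
    module N (i : I) where
      open Module (N i) public
      open IsModuleHomomorphism (f-homo i) public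
      open import Algebra.Properties.AbelianGroup +ᴹ-abelianGroup public using (ε⁻¹≈ε)

  _∈⋂ker : Carrierᴹ → Set (ι ⊔ ℓn)
  x ∈⋂ker = ∀ (i : I) → N._≈ᴹ_ i (f i x) (N.0ᴹ i)

  private
    raw : RawModule (CommutativeRing.Carrier A) (m ⊔ ι ⊔ ℓn) ℓm
    raw = record
      { Carrierᴹ = Σ Carrierᴹ _∈⋂ker
      ; _≈ᴹ_     = λ x y → proj₁ x ≈ᴹ proj₁ y
      ; _+ᴹ_     = λ (x , fx≈0) (y , fy≈0) → x +ᴹ y , λ i →
          N.≈ᴹ-trans i (N.+ᴹ-homo i x y)
            (N.≈ᴹ-trans i (N.+ᴹ-cong i (fx≈0 i) (fy≈0 i)) (N.+ᴹ-identityˡ i _))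
      ; _*ₗ_     = λ c (x , fx≈0) → c *ₗ x , λ i →
          N.≈ᴹ-trans i (N.*ₗ-homo i c x)
            (N.≈ᴹ-trans i (N.*ₗ-congˡ i (fx≈0 i)) (N.*ₗ-zeroʳ i c))
      ; _*ᵣ_     = λ (x , fx≈0) c → x *ᵣ c , λ i →
          N.≈ᴹ-trans i (N.*ᵣ-homo i c x)
            (N.≈ᴹ-trans i (N.*ᵣ-congʳ i (fx≈0 i)) (N.*ᵣ-zeroˡ i c))
      ; 0ᴹ       = 0ᴹ , N.0ᴹ-homo
      ; -ᴹ_      = λ (x , fx≈0) → -ᴹ x , λ i →
          N.≈ᴹ-trans i (N.-ᴹ-homo i x)
            (N.≈ᴹ-trans i (N.-ᴹ‿cong i (fx≈0 i)) (N.ε⁻¹≈ε i))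
      }

    proj₁-mono : IsModuleMonomorphism raw M.rawModule proj₁
    proj₁-mono = record
      { isModuleHomomorphism = record
        { isBimoduleHomomorphism = record
          { +ᴹ-isGroupHomomorphism = record
            { isMonoidHomomorphism = record
              { isMagmaHomomorphism = record
                { isRelHomomorphism = record { cong = id }
                ; homo = λ _ _ → M.≈ᴹ-refl
                }
              ; ε-homo = M.≈ᴹ-refl
              }
            ; ⁻¹-homo = λ _ → M.≈ᴹ-refl
            }
          ; *ₗ-homo = λ _ _ → M.≈ᴹ-refl
          ; *ᵣ-homo = λ _ _ → M.≈ᴹ-refl
          }
        }
      ; injective = id
      }

  ⋂ker : Module A (m ⊔ ι ⊔ ℓn) ℓm
  ⋂ker = record
    { RawModule raw
    ; isModule = ModuleMonomorphism.isModule proj₁-mono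
        (CommutativeRing.isCommutativeRing A) M.isModule
    }

module _ {a ℓa} (A : CommutativeRing a ℓa) where
  open CommutativeRing A hiding (_+_)

  functions : Set → Module A a ℓa
  functions I = record
    { isModule = IsModuleFromLeft.isModule {commutativeRing = A} record
      { isLeftModule = record
        { isLeftSemimodule = record
          { +ᴹ-isCommutativeMonoid = AbelianGroup.isCommutativeMonoid +ᴵ
          ; isPreleftSemimodule = record
            { *ₗ-cong      = λ x≈y S≈T i → *-cong x≈y (S≈T i)
            ; *ₗ-zeroˡ     = λ T i → zeroˡ (T i)
            ; *ₗ-distribʳ  = λ T x y i → distribʳ (T i) x y
            ; *ₗ-identityˡ = λ T i → *-identityˡ (T i)
            ; *ₗ-assoc     = λ x y T i → *-assoc x y (T i)
            ; *ₗ-zeroʳ     = λ x i → zeroʳ x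
            ; *ₗ-distribˡ  = λ x S T i → distribˡ x (S i) (T i)
            }
          }
        ; -ᴹ‿cong    = AbelianGroup.⁻¹-cong +ᴵ
        ; -ᴹ‿inverse = AbelianGroup.inverse +ᴵ
        }
      }
    }
    where
    +ᴵ : AbelianGroup a ℓa
    +ᴵ = Pointwise.abelianGroup I +-abelianGroup

  precompose-homo : ∀ {I J : Set} (φ : I → J) →
    IsModuleHomomorphism (Module.rawModule (functions J)) (Module.rawModule (functions I)) (_∘ φ)
  precompose-homo φ = record
    { isBimoduleHomomorphism = record
      { +ᴹ-isGroupHomomorphism = record
        { isMonoidHomomorphism = record
          { isMagmaHomomorphism = record
            { isRelHomomorphism = record { cong = λ S≈T → S≈T ∘ φ }
            ; homo = λ _ _ _ → refl
            }
          ; ε-homo = λ _ → refl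
          }
        ; ⁻¹-homo = λ _ _ → refl
        }
      ; *ₗ-homo = λ _ _ _ → refl
      ; *ᵣ-homo = λ _ _ _ → refl
      }
    }

-- The shape s = (n₁ , … , nₖ) has length k = suc k′ ≥ 1; [q] = {0 , … , q} is
-- encoded as Fin (suc q).
module _ {k′ : ℕ} (s : Vec ℕ (suc k′)) where

  dim : ℕ
  dim = foldr₁ _⊓_ s ∸ 1

  excess : ℕ → ℕ
  excess nₐ = nₐ ∸ 1 ∸ dim

  -- Mₐ(p) = nₐ - 1 - n + p as a function of nₐ, where n = dim.  No truncation
  -- occurs for the entries nₐ of a positive shape, as n ≤ nₐ - 1.  With p as the
  -- first summand, Mₐ(suc p) is definitionally suc (Mₐ(p)).
  M : ℕ → ℕ → ℕ
  M nₐ p = p + excess nₐ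

  -- I_p = ∏ₐ [Mₐ(p)].  Tuples rather than dependent functions, so that without
  -- function extensionality a map out of I p is still just a map of sets.
  I : ℕ → Set
  I p = All (λ nₐ → Fin (suc (M nₐ p))) s

  -- ∏ₐ δ_i, where δ_i = punchIn i and i ∈ [p] is regarded as an element of
  -- [Mₐ(p)] ⊇ [p].
  Δ : ∀ p .{{_ : NonZero p}} → Fin (suc p) → I (pred p) → I p
  Δ (suc p) i = All.map (λ {nₐ} → punchIn (i ↑ˡ excess nₐ))

  -- ∏ₐ σ_i, where σ_i = pinch i.
  Σσ : ∀ p → Fin (suc p) → I (suc p) → I p
  Σσ p i = All.map (λ {nₐ} → pinch (i ↑ˡ excess nₐ))

  module _ {a ℓa} (A : CommutativeRing a ℓa) where

    X : ℕ → Module A a ℓa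
    X p = functions A (I p)

    face : ∀ p .{{_ : NonZero p}} → Fin (suc p) →
           Module.Carrierᴹ (X p) → Module.Carrierᴹ (X (pred p))
    face p i T = T ∘ Δ p i

    degeneracy : ∀ p → Fin (suc p) →
                 Module.Carrierᴹ (X p) → Module.Carrierᴹ (X (suc p))
    degeneracy p i T = T ∘ Σσ p i

    R : ∀ p .{{_ : NonZero p}} → Fin (suc p) → Module A (a ⊔ ℓa) ℓa
    R p j = ⋂ker (X p) {I = ∃ λ i → i ≢ j} (λ _ → X (pred p))
      (λ (i , _) → face p i) (λ (i , _) → precompose-homo A (Δ p i))

-- Since the image of Δ i consists of the tuples none of whose entries is i, the
-- module R p j consists of the functions supported on the tuples in which every
-- i ≢ j occurs.  The indicator functions of these tuples form a basis, and
-- inclusion–exclusion over the p required values counts them: the tuples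
-- avoiding t given values number ∏ₐ (Mₐ(p) + 1 - t).

module Submission where

open import Defs
open import Algebra.Bundles using (CommutativeRing)
open import Data.Fin.Base using (Fin; toℕ)
open import Data.Integer.Base using (+_; _-_; _*_; _^_; 1ℤ; -1ℤ)
open import Data.Integer.Properties using (+-0-commutativeMonoid)
open import Algebra.Properties.CommutativeMonoid.Sum +-0-commutativeMonoid using (sum⁺-syntax)
open import Data.Nat.Base using (ℕ; suc; NonZero)
open import Data.Nat.Combinatorics using (_C_)
open import Data.Product.Base using (∃; _×_)
open import Data.Vec.Base using (Vec; map; foldr′)
open import Data.Vec.Relation.Unary.All using (All)
open import Relation.Binary.PropositionalEquality.Core using (_≡_)

open import Algebra.Module.Bundles using (Module)
import Algebra.Properties.CommutativeMonoid.Sum as CommutativeMonoidSum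
import Algebra.Properties.Semiring.Sum as SemiringSum
open import Data.Bool.Base using (if_then_else_; true; false)
open import Data.Fin.Base using (zero; suc; inject₁; fromℕ; punchIn; punchOut; _↑ˡ_)
import Data.Fin.Properties as Fin
open import Data.Integer.Base as ℤ using (ℤ; 0ℤ; _+_)
import Data.Integer.Properties as ℤ
open import Data.Integer.Tactic.RingSolver using (solve-∀)
open import Data.List.Base as List
  using (List; []; _∷_; _++_; length; filter; cartesianProductWith; allFin; tabulate; lookup)
import Data.List.Properties as List
open import Data.List.Membership.Propositional using (_∈_; _∉_; find)
open import Data.List.Membership.Propositional.Properties
  using (∈-filter⁺; ∈-filter⁻; ∈-allFin; ∈-tabulate⁺; ∈-tabulate⁻; ∈-lookup; ∈-cartesianProductWith⁺)
open import Data.List.Relation.Binary.Sublist.Propositional using (_⊆_; []; _∷_; _∷ʳ_)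
open import Data.List.Relation.Binary.Sublist.Propositional.Properties using (All-resp-⊆)
import Data.List.Relation.Unary.All as ListAll
import Data.List.Relation.Unary.All.Properties as ListAll
open import Data.List.Relation.Unary.Any using (here; there; index)
open import Data.List.Relation.Unary.Any.Properties using (lookup-index)
open import Data.List.Relation.Unary.Unique.Propositional using (Unique; []; _∷_)
open import Data.List.Relation.Unary.Unique.Propositional.Properties as Unique using (Unique[x∷xs]⇒x∉xs)
import Data.Nat.Base as ℕ
import Data.Nat.Properties as ℕ
open import Data.Nat.Combinatorics using (nCk+nC[k+1]≡[n+1]C[k+1]; k>n⇒nCk≡0)
open import Data.Product.Base using (_,_; proj₁; proj₂; uncurry)
open import Data.Sum.Base using (_⊎_; inj₁; inj₂)
open import Data.Vec.Base using ([]; _∷_)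
open import Data.Vec.Functional using (Vector)
import Data.Vec.Properties as Vec
open import Data.Vec.Relation.Unary.All as All using ([]; _∷_)
open import Function.Base using (_∘_; id)
open import Level using (Level)
open import Relation.Binary.Definitions using (DecidableEquality)
open import Relation.Binary.PropositionalEquality
  using (_≢_; _≗_; refl; sym; trans; cong; cong₂; subst; module ≡-Reasoning)
open import Relation.Nullary using (yes; no; does; ¬_; ¬?; _×-dec_)
open import Relation.Nullary.Decidable using (map′; dec-true; dec-false; decidable-stable)
open import Relation.Unary using (Pred; Decidable; _∩_; _≐_)
open import Relation.Unary.Properties using (∁?)

-- Filtering and counting in lists

private variable
  ℓ₁ ℓ₂ ℓ₃ : Level
  S T U : Set
  xs ys : List S

Unique-resp-⊆ : xs ⊆ ys → Unique ys → Unique xs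
Unique-resp-⊆ []         []         = []
Unique-resp-⊆ (_ ∷ʳ τ)   (_ ∷ ys!)  = Unique-resp-⊆ τ ys!
Unique-resp-⊆ (refl ∷ τ) (y∉ ∷ ys!) = All-resp-⊆ τ y∉ ∷ Unique-resp-⊆ τ ys!

length-filter-∁ : {P : Pred S ℓ₁} (P? : Decidable P) (xs : List S) →
  length (filter P? xs) ℕ.+ length (filter (∁? P?) xs) ≡ length xs
length-filter-∁ P? []       = refl
length-filter-∁ P? (x ∷ xs) with does (P? x)
... | true  = cong suc (length-filter-∁ P? xs)
... | false = trans (ℕ.+-suc _ _) (cong suc (length-filter-∁ P? xs))

module _ {P : Pred S ℓ₁} {Q : Pred S ℓ₂} {R : Pred S ℓ₃}
  (P? : Decidable P) (Q? : Decidable Q) (R? : Decidable R) where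

  -- The conjunction is any `R` equivalent to `P ∩ Q`, with its own decision procedure, so that
  -- `All` over a cons fits as well as a literal product.
  filter-∩ : R ≐ P ∩ Q → filter P? ∘ filter Q? ≗ filter R?
  filter-∩ R≐ []       = refl
  filter-∩ R≐ (x ∷ xs) with Q? x
  ... | no ¬q = trans (filter-∩ R≐ xs) (sym (List.filter-reject R? (¬q ∘ proj₂ ∘ proj₁ R≐)))
  ... | yes q with P? x
  ...   | no ¬p = trans (filter-∩ R≐ xs) (sym (List.filter-reject R? (¬p ∘ proj₁ ∘ proj₁ R≐)))
  ...   | yes p = trans (cong (x ∷_) (filter-∩ R≐ xs)) (sym (List.filter-accept R? (proj₂ R≐ (p , q))))

filter-comm : {P : Pred S ℓ₁} {Q : Pred S ℓ₂} (P? : Decidable P) (Q? : Decidable Q) →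
  filter P? ∘ filter Q? ≗ filter Q? ∘ filter P?
filter-comm P? Q? xs = trans
  (filter-∩ P? Q? (λ x → P? x ×-dec Q? x) ((λ r → r) , (λ r → r)) xs)
  (sym (filter-∩ Q? P? _ ((λ (p , q) → q , p) , (λ (q , p) → p , q)) xs))

-- The product is listed row by row: the row of an `x` with `P x` is filtered by `Q`, and the row of
-- any other `x` disappears.
filter-cartesianProductWith :
  {P : Pred S ℓ₁} {Q : Pred T ℓ₂} {R : Pred U ℓ₃}
  (P? : Decidable P) (Q? : Decidable Q) (R? : Decidable R) (f : S → T → U) →
  (∀ {x y} → P x → Q y → R (f x y)) → (∀ {x y} → R (f x y) → P x × Q y) →
  ∀ xs ys → filter R? (cartesianProductWith f xs ys) ≡ cartesianProductWith f (filter P? xs) (filter Q? ys)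
filter-cartesianProductWith P? Q? R? f pq⇒r r⇒pq = go
  where
  accepted : ∀ {x} → _ → ∀ ys → filter R? (List.map (f x) ys) ≡ List.map (f x) (filter Q? ys)
  accepted p []       = refl
  accepted p (y ∷ ys) with Q? y
  ... | yes q = trans (List.filter-accept R? (pq⇒r p q)) (cong (_ ∷_) (accepted p ys))
  ... | no ¬q = trans (List.filter-reject R? (¬q ∘ proj₂ ∘ r⇒pq)) (accepted p ys)

  go : ∀ xs ys → filter R? (cartesianProductWith f xs ys) ≡ cartesianProductWith f (filter P? xs) (filter Q? ys)
  go []       ys = refl
  go (x ∷ xs) ys with P? x
  ... | yes p = trans (List.filter-++ R? (List.map (f x) ys) _) (cong₂ _++_ (accepted p ys) (go xs ys))
  ... | no ¬p = trans (List.filter-++ R? (List.map (f x) ys) _)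
    (cong₂ _++_ (List.filter-none R? (ListAll.map⁺ (ListAll.universal (λ _ → ¬p ∘ proj₁ ∘ r⇒pq) ys)))
      (go xs ys))

length-cartesianProductWith : (f : S → T → U) → ∀ xs ys →
  length (cartesianProductWith f xs ys) ≡ length xs ℕ.* length ys
length-cartesianProductWith f []       ys = refl
length-cartesianProductWith f (x ∷ xs) ys = trans (List.length-++ (List.map (f x) ys))
  (cong₂ ℕ._+_ (List.length-map (f x) ys) (length-cartesianProductWith f xs ys))

module _ {S : Set} (_≟_ : DecidableEquality S) where

  length-filter-≢ : ∀ {x xs} → Unique xs → x ∈ xs →
    suc (length (filter (∁? (_≟ x)) xs)) ≡ length xs
  length-filter-≢ (y∉ ∷ _) (here refl) = cong suc (trans
    (cong length (List.filter-reject (∁? (_≟ _)) (λ y≢y → y≢y refl)))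
    (cong length (List.filter-all (∁? (_≟ _)) (ListAll.map (_∘ sym) y∉))))
  length-filter-≢ (y∉ ∷ xs!) (there x∈) = cong suc (trans
    (cong length (List.filter-accept (∁? (_≟ _)) (ListAll.lookup y∉ x∈)))
    (length-filter-≢ xs! x∈))

  -- Induction on `is`: once the other values are filtered out, `ι i` is still present, because `ι`
  -- is injective and `i` does not recur in `is`, and removing it costs exactly one element. The
  -- additive form avoids truncated subtraction.
  length-filter-∉ : {I : Set} (ι : I → S) → (∀ {i j} → ι i ≡ ι j → i ≡ j) →
    ∀ {is xs} → Unique is → Unique xs → (∀ i → ι i ∈ xs) →
    length (filter (λ x → ListAll.all? (λ i → ¬? (x ≟ ι i)) is) xs) ℕ.+ length is ≡ length xs
  length-filter-∉ ι ι-inj {[]} {xs} [] xs! ι∈ = trans (ℕ.+-identityʳ _)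
    (cong length (List.filter-all _ (ListAll.universal (λ _ → ListAll.[]) xs)))
  length-filter-∉ ι ι-inj {i ∷ is} {xs} (i∉ ∷ is!) xs! ι∈ = begin
    length (filter (avoids (i ∷ is)) xs) ℕ.+ suc (length is)
      ≡⟨ ℕ.+-suc _ _ ⟩
    suc (length (filter (avoids (i ∷ is)) xs)) ℕ.+ length is
      ≡⟨ cong (λ ys → suc (length ys) ℕ.+ length is)
           (filter-∩ (∁? (_≟ ι i)) (avoids is) (avoids (i ∷ is)) (ListAll.uncons , uncurry ListAll._∷_) xs) ⟨
    suc (length (filter (∁? (_≟ ι i)) (filter (avoids is) xs))) ℕ.+ length is
      ≡⟨ cong (ℕ._+ length is) (length-filter-≢ (Unique.filter⁺ (avoids is) xs!)
           (∈-filter⁺ (avoids is) (ι∈ i) (ListAll.map (_∘ ι-inj) i∉))) ⟩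
    length (filter (avoids is) xs) ℕ.+ length is
      ≡⟨ length-filter-∉ ι ι-inj is! xs! ι∈ ⟩
    length xs ∎
    where
    open ≡-Reasoning
    avoids : ∀ is → Decidable (λ x → ListAll.All (λ i → x ≢ ι i) is)
    avoids is x = ListAll.all? (λ i → ¬? (x ≟ ι i)) is

-- Inclusion–exclusion

module _ where
  open SemiringSum ℤ.+-*-semiring using (sum-cong-≗; sum-init-last; ∑-distrib-+; *-distribˡ-sum)
  open ≡-Reasoning

  private
    term : ℕ → (ℕ → ℤ) → ℕ → ℤ
    term n f t = -1ℤ ^ t * + (n C t) * f t

  -- With the shift `(E f)(t) = f(t + 1)` this is the finite difference `((1 - E)^n f)(0)`. The
  -- summand has the exact shape used in the theorem.
  alternatingSum : ℕ → (ℕ → ℤ) → ℤ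
  alternatingSum n f = ∑[ t ≤ n ] (-1ℤ ^ toℕ t * + (n C toℕ t) * f (toℕ t))

  private
    term-pascal : ∀ n f t → term (suc n) f (suc t) ≡ term n f (suc t) + -1ℤ * term n (f ∘ suc) t
    term-pascal n f t = begin
      -1ℤ ^ suc t * + (suc n C suc t) * f (suc t)
        ≡⟨ cong (λ c → -1ℤ ^ suc t * + c * f (suc t)) (nCk+nC[k+1]≡[n+1]C[k+1] n t) ⟨
      -1ℤ ^ suc t * (+ (n C t) + + (n C suc t)) * f (suc t)
        ≡⟨ expand (-1ℤ ^ t) (+ (n C t)) (+ (n C suc t)) (f (suc t)) ⟩
      term n f (suc t) + -1ℤ * term n (f ∘ suc) t ∎
      where
      expand : ∀ s a b y → -1ℤ * s * (a + b) * y ≡ -1ℤ * s * b * y + -1ℤ * (s * a * y)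
      expand = solve-∀

  -- In terms of the shift, `(1 - E)^(n+1) = (1 - E)^n - (1 - E)^n E`; on coefficients this is
  -- Pascal's rule.
  alternatingSum-suc : ∀ n f →
    alternatingSum (suc n) f ≡ alternatingSum n f + -1ℤ * alternatingSum n (f ∘ suc)
  alternatingSum-suc n f = begin
    term (suc n) f 0 + ∑[ t ≤ n ] term (suc n) f (suc (toℕ t))
      -- The terms at `t = 0` for `suc n` and for `n` agree by computation, so Pascal's rule is
      -- applied only to the later ones.
      ≡⟨ cong (λ Σ → term (suc n) f 0 + Σ)
           (sum-cong-≗ {suc n} {λ t → term (suc n) f (suc (toℕ t))} (λ t → term-pascal n f (toℕ t))) ⟩
    term n f 0 + ∑[ t ≤ n ] (term n f (suc (toℕ t)) + -1ℤ * term n (f ∘ suc) (toℕ t))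
      ≡⟨ cong (λ Σ → term n f 0 + Σ)
           (∑-distrib-+ {suc n} (λ t → term n f (suc (toℕ t))) (λ t → -1ℤ * term n (f ∘ suc) (toℕ t))) ⟩
    term n f 0 + (∑[ t ≤ n ] term n f (suc (toℕ t)) + ∑[ t ≤ n ] (-1ℤ * term n (f ∘ suc) (toℕ t)))
      ≡⟨ ℤ.+-assoc (term n f 0) _ _ ⟨
    ∑[ t ≤ suc n ] term n f (toℕ t) + ∑[ t ≤ n ] (-1ℤ * term n (f ∘ suc) (toℕ t))
      -- The first sum runs one index too far; its last term has the coefficient `n C suc n`, which
      -- is 0.
      ≡⟨ cong₂ _+_ (sum-init-last {suc n} (λ t → term n f (toℕ t)))
           (sym (*-distribˡ-sum {suc n} -1ℤ (λ t → term n (f ∘ suc) (toℕ t)))) ⟩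
    ∑[ t ≤ n ] term n f (toℕ (inject₁ t)) + term n f (toℕ (fromℕ (suc n))) + -1ℤ * alternatingSum n (f ∘ suc)
      ≡⟨ cong (ℤ._+ -1ℤ * alternatingSum n (f ∘ suc)) (cong₂ _+_
           (sum-cong-≗ {suc n} (λ t → cong (term n f) (Fin.toℕ-inject₁ t)))
           (trans (cong (term n f) (Fin.toℕ-fromℕ (suc n))) last≡0)) ⟩
    alternatingSum n f + 0ℤ + -1ℤ * alternatingSum n (f ∘ suc)
      ≡⟨ cong (ℤ._+ -1ℤ * alternatingSum n (f ∘ suc)) (ℤ.+-identityʳ (alternatingSum n f)) ⟩
    alternatingSum n f + -1ℤ * alternatingSum n (f ∘ suc) ∎
    where
    last≡0 : term n f (suc n) ≡ 0ℤ
    last≡0 = trans (cong (λ c → -1ℤ ^ suc n * + c * f (suc n)) (k>n⇒nCk≡0 (ℕ.n<1+n n)))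
      (cong (_* f (suc n)) (ℤ.*-zeroʳ (-1ℤ ^ suc n)))

module _ {I S : Set} {Miss : I → S → Set} (miss? : ∀ i → Decidable (Miss i)) where

  missAll? : ∀ is → Decidable (λ x → ListAll.All (λ i → Miss i x) is)
  missAll? is x = ListAll.all? (λ i → miss? i x) is

  hitAll? : ∀ is → Decidable (λ x → ListAll.All (λ i → ¬ Miss i x) is)
  hitAll? is x = ListAll.all? (λ i → ¬? (miss? i x)) is

  -- Induction on `is`, for all `xs` and `f` at once. The elements satisfying every condition of
  -- `i ∷ is` are those satisfying `is`, less those among them that miss `i`; both counts are
  -- instances for `is`, and `alternatingSum-suc` combines them. The hypothesis concerns sublists of
  -- `is` only, so that it can be met when repetitions must be excluded.
  inclusion–exclusion : ∀ is xs f →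
    (∀ {js} → js ⊆ is → + length (filter (missAll? js) xs) ≡ f (length js)) →
    + length (filter (hitAll? is) xs) ≡ alternatingSum (length is) f
  inclusion–exclusion [] xs f count = begin
    + length (filter (hitAll? []) xs)
      ≡⟨ cong (λ ys → + length ys)
           (List.filter-≐ (hitAll? []) (missAll? []) ((λ _ → ListAll.[]) , (λ _ → ListAll.[])) xs) ⟩
    + length (filter (missAll? []) xs) ≡⟨ count [] ⟩
    f 0                                ≡⟨ ℤ.*-identityˡ (f 0) ⟨
    1ℤ * f 0                           ≡⟨ ℤ.+-identityʳ (1ℤ * f 0) ⟨
    1ℤ * f 0 + 0ℤ                      ∎
    where open ≡-Reasoning
  inclusion–exclusion (i ∷ is) xs f count = begin
    + length (filter (hitAll? (i ∷ is)) xs)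
      ≡⟨ cong (λ ys → + length ys)
           (filter-∩ (∁? (miss? i)) (hitAll? is) (hitAll? (i ∷ is)) (ListAll.uncons , uncurry ListAll._∷_) xs) ⟨
    + length (filter (∁? (miss? i)) (filter (hitAll? is) xs))
      ≡⟨ isolate (+ length (filter (miss? i) (filter (hitAll? is) xs))) _ _
           (trans (sym (ℤ.pos-+ (length (filter (miss? i) (filter (hitAll? is) xs))) _))
             (cong +_ (length-filter-∁ (miss? i) (filter (hitAll? is) xs)))) ⟩
    + length (filter (hitAll? is) xs) + -1ℤ * + length (filter (miss? i) (filter (hitAll? is) xs))
      -- With the filters exchanged, the subtracted term is the same problem for the shorter list
      -- `filter (miss? i) xs`.
      ≡⟨ cong (λ ys → + length (filter (hitAll? is) xs) + -1ℤ * + length ys)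
           (filter-comm (miss? i) (hitAll? is) xs) ⟩
    + length (filter (hitAll? is) xs) + -1ℤ * + length (filter (hitAll? is) (filter (miss? i) xs))
      ≡⟨ cong₂ (λ a b → a + -1ℤ * b)
           (inclusion–exclusion is xs f (λ js⊆is → count (i ∷ʳ js⊆is)))
           (inclusion–exclusion is (filter (miss? i) xs) (f ∘ suc) count′) ⟩
    alternatingSum (length is) f + -1ℤ * alternatingSum (length is) (f ∘ suc)
      ≡⟨ alternatingSum-suc (length is) f ⟨
    alternatingSum (suc (length is)) f ∎
    where
    open ≡-Reasoning
    isolate : ∀ a b c → a + b ≡ c → b ≡ c + -1ℤ * a
    isolate a b _ refl = lemma a b
      where
      lemma : ∀ a b → b ≡ a + b + -1ℤ * a
      lemma = solve-∀

    -- Missing `js` among the elements that miss `i` means missing `i ∷ js`, which is one longer;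
    -- hence the shift `f ∘ suc`.
    count′ : ∀ {js} → js ⊆ is → + length (filter (missAll? js) (filter (miss? i) xs)) ≡ f (suc (length js))
    count′ {js} js⊆is = trans
      (cong (λ ys → + length ys) (filter-∩ (missAll? js) (miss? i) (missAll? (i ∷ js))
        ((λ ms → ListAll.tail ms , ListAll.head ms) , (λ (ms , m) → m ListAll.∷ ms)) xs))
      (count (refl ∷ js⊆is))

-- Tuples

module _ {A : Set} {P : A → Set} where

  -- Each entry is paired with its index, which lets `All` on vectors express conditions on entries
  -- whose types vary along `s`.
  components : ∀ {n} {s : Vec A n} → All P s → Vec (∃ P) n
  components = All.reduce (_ ,_)

  Everywhere : (∀ a → P a → Set) → ∀ {n} {s : Vec A n} → All P s → Set
  Everywhere Q x = All (uncurry Q) (components x)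

  everywhere? : {Q : ∀ a → P a → Set} → (∀ a → Decidable (Q a)) →
    ∀ {n} {s : Vec A n} → Decidable (Everywhere Q {s = s})
  everywhere? Q? x = All.all? (uncurry Q?) (components x)

  module _ {I : Set} {Q : I → ∀ a → P a → Set} where

    -- Here and in `everywhere-all` the quantifiers over conditions and positions are exchanged. A
    -- conjunction of conditions thus becomes a separate condition on each entry, and the tuples
    -- satisfying it form a product.
    all-everywhere : ∀ {n} {s : Vec A n} {is} (x : All P s) →
      ListAll.All (λ i → Everywhere (Q i) x) is → Everywhere (λ a c → ListAll.All (λ i → Q i a c) is) x
    all-everywhere []      _  = []
    all-everywhere (c ∷ x) qs = ListAll.map All.head qs ∷ all-everywhere x (ListAll.map All.tail qs)

    everywhere-all : ∀ {n} {s : Vec A n} is {x : All P s} →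
      Everywhere (λ a c → ListAll.All (λ i → Q i a c) is) x → ListAll.All (λ i → Everywhere (Q i) x) is
    everywhere-all []       _  = ListAll.[]
    everywhere-all (i ∷ is) qs = All.map ListAll.head qs ListAll.∷ everywhere-all is (All.map ListAll.tail qs)

  tuples : (∀ a → List (P a)) → ∀ {n} (s : Vec A n) → List (All P s)
  tuples L []      = [] ∷ []
  tuples L (a ∷ s) = cartesianProductWith _∷_ (L a) (tuples L s)

  tuples-unique : {L : ∀ a → List (P a)} → (∀ a → Unique (L a)) → ∀ {n} (s : Vec A n) → Unique (tuples L s)
  tuples-unique L! []      = ListAll.[] ∷ []
  tuples-unique L! (a ∷ s) = Unique.cartesianProductWith⁺ _∷_
    (λ eq → cong All.head eq , cong All.tail eq) (L! a) (tuples-unique L! s)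

  ∈-tuples : {L : ∀ a → List (P a)} → (∀ {a} c → c ∈ L a) →
    ∀ {n} {s : Vec A n} (x : All P s) → x ∈ tuples L s
  ∈-tuples ∈L []      = here refl
  ∈-tuples ∈L (c ∷ x) = ∈-cartesianProductWith⁺ _∷_ (∈L c) (∈-tuples ∈L x)

  length-tuples : (L : ∀ a → List (P a)) → ∀ {n} (s : Vec A n) →
    + length (tuples L s) ≡ foldr′ _*_ 1ℤ (map (λ a → + length (L a)) s)
  length-tuples L []      = refl
  length-tuples L (a ∷ s) = trans (cong +_ (length-cartesianProductWith _∷_ (L a) (tuples L s)))
    (trans (ℤ.pos-* (length (L a)) _) (cong (+ length (L a) *_) (length-tuples L s)))

  filter-tuples : {Q : ∀ a → P a → Set} (Q? : ∀ a → Decidable (Q a)) (L : ∀ a → List (P a)) →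
    ∀ {n} (s : Vec A n) → filter (everywhere? Q?) (tuples L s) ≡ tuples (λ a → filter (Q? a) (L a)) s
  filter-tuples Q? L []      = refl
  filter-tuples Q? L (a ∷ s) = trans
    (filter-cartesianProductWith (Q? a) (everywhere? Q?) (everywhere? Q?) _∷_ _∷_ All.uncons (L a) (tuples L s))
    (cong (cartesianProductWith _∷_ (filter (Q? a) (L a))) (filter-tuples Q? L s))

  ≡-dec : (∀ {a} → DecidableEquality (P a)) → ∀ {n} {s : Vec A n} → DecidableEquality (All P s)
  ≡-dec _≟_ []      []      = yes refl
  ≡-dec _≟_ (c ∷ x) (d ∷ y) = map′ (uncurry (cong₂ _∷_))
    (λ eq → cong All.head eq , cong All.tail eq) (c ≟ d ×-dec ≡-dec _≟_ x y)

module _ {A I : Set} {P : A → Set} (_≟_ : ∀ {a} → DecidableEquality (P a)) (ι : ∀ a → I → P a) where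

  -- `ι a` embeds the common set of values `I` into the type of entries at `a`, so one `i` can be
  -- compared with entries of different types.
  Misses : I → ∀ {n} {s : Vec A n} → All P s → Set
  Misses i = Everywhere (λ a c → c ≢ ι a i)

  misses? : ∀ i {n} {s : Vec A n} → Decidable (Misses i {s = s})
  misses? i = everywhere? (λ a c → ¬? (c ≟ ι a i))

  -- The tuples missing all of `is` form the product of the sets of entries avoiding `is`. By
  -- injectivity of `ι a`, each factor loses exactly `length is` elements.
  length-misses : (∀ a {i j} → ι a i ≡ ι a j → i ≡ j) →
    ∀ {L : ∀ a → List (P a)} → (∀ a → Unique (L a)) → (∀ {a} c → c ∈ L a) →
    ∀ {n} (s : Vec A n) {is} → Unique is →
    + length (filter (missAll? (λ i → misses? i) is) (tuples L s)) ≡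
    foldr′ _*_ 1ℤ (map (λ a → + length (L a) - + length is) s)
  length-misses ι-inj {L} L! ∈L s {is} is! = begin
    + length (filter (missAll? (λ i → misses? i) is) (tuples L s))
      ≡⟨ cong (λ xs → + length xs) (List.filter-≐ (missAll? (λ i → misses? i) is) (everywhere? avoids?)
           (all-everywhere _ , everywhere-all is) (tuples L s)) ⟩
    + length (filter (everywhere? avoids?) (tuples L s))
      ≡⟨ cong (λ xs → + length xs) (filter-tuples avoids? L s) ⟩
    + length (tuples (λ a → filter (avoids? a) (L a)) s)
      ≡⟨ length-tuples (λ a → filter (avoids? a) (L a)) s ⟩
    foldr′ _*_ 1ℤ (map (λ a → + length (filter (avoids? a) (L a))) s)
      ≡⟨ cong (foldr′ _*_ 1ℤ) (Vec.map-cong length-avoids s) ⟩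
    foldr′ _*_ 1ℤ (map (λ a → + length (L a) - + length is) s) ∎
    where
    open ≡-Reasoning
    avoids? : ∀ a → Decidable (λ (c : P a) → ListAll.All (λ i → c ≢ ι a i) is)
    avoids? a c = ListAll.all? (λ i → ¬? (c ≟ ι a i)) is

    add-sub : ∀ a b → a ≡ a + b - b
    add-sub = solve-∀

    length-avoids : ∀ a → + length (filter (avoids? a) (L a)) ≡ + length (L a) - + length is
    length-avoids a = trans (add-sub _ (+ length is)) (cong (λ n → + n - + length is)
      (length-filter-∉ _≟_ (ι a) (ι-inj a) is! (L! a) (λ i → ∈L (ι a i))))

  module _ {P′ : A → Set} {i : I} (δ : ∀ {a} → P′ a → P a) where

    -- Together with `misses⇒map`: if each `δ` hits exactly the entries other than `ι a i`, the
    -- image of the product map is exactly the set of tuples missing `i`.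
    misses-map : (∀ {a} d → δ {a} d ≢ ι a i) → ∀ {n} {s : Vec A n} (y : All P′ s) → Misses i (All.map δ y)
    misses-map δ≢ []      = []
    misses-map δ≢ (d ∷ y) = δ≢ d ∷ misses-map δ≢ y

    misses⇒map : (∀ {a} c → c ≢ ι a i → ∃ λ d → δ d ≡ c) →
      ∀ {n} {s : Vec A n} (x : All P s) → Misses i x → ∃ λ y → All.map δ y ≡ x
    misses⇒map ≢⇒δ []      []        = [] , refl
    misses⇒map ≢⇒δ (c ∷ x) (c≢ ∷ ms)
      with d , refl ← ≢⇒δ c c≢ | y , refl ← misses⇒map ≢⇒δ x ms = d ∷ y , refl

-- Functions with prescribed support

module _ {a ℓ} (A : CommutativeRing a ℓ) {I : Set} (_≟_ : DecidableEquality I) where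
  private module A = CommutativeRing A
  open A using (Carrier; _≈_; 0#; 1#)
  open CommutativeMonoidSum A.+-commutativeMonoid using (sum)

  indicator : I → I → Carrier
  indicator x y = if does (x ≟ y) then 1# else 0#

  indicator-≡ : ∀ x → indicator x x ≡ 1#
  indicator-≡ x rewrite dec-true (x ≟ x) refl = refl

  indicator-≢ : ∀ {x y} → x ≢ y → indicator x y ≡ 0#
  indicator-≢ {x} {y} x≢y rewrite dec-false (x ≟ y) x≢y = refl

  private
    *-indicator-≢ : ∀ c {x y} → x ≢ y → c A.* indicator x y ≈ 0#
    *-indicator-≢ c x≢y = A.trans (A.*-congˡ (A.reflexive (indicator-≢ x≢y))) (A.zeroʳ c)

  sum-indicator-∉ : ∀ xs (c : Vector Carrier (length xs)) {y} → y ∉ xs →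
    sum (λ l → c l A.* indicator (lookup xs l) y) ≈ 0#
  sum-indicator-∉ []       c y∉ = A.refl
  sum-indicator-∉ (x ∷ xs) c y∉ = A.trans
    (A.+-cong (*-indicator-≢ _ (y∉ ∘ here ∘ sym)) (sum-indicator-∉ xs (c ∘ suc) (y∉ ∘ there)))
    (A.+-identityˡ 0#)

  -- Since the entries of `xs` are distinct, every indicator but the `m`-th vanishes at
  -- `lookup xs m`.
  sum-indicator-lookup : ∀ {xs} (c : Vector Carrier (length xs)) → Unique xs → ∀ m →
    sum (λ l → c l A.* indicator (lookup xs l) (lookup xs m)) ≈ c m
  sum-indicator-lookup {x ∷ xs} c xs! zero = A.trans
    (A.+-cong (A.trans (A.*-congˡ (A.reflexive (indicator-≡ x))) (A.*-identityʳ _))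
      (sum-indicator-∉ xs (c ∘ suc) (Unique[x∷xs]⇒x∉xs xs!)))
    (A.+-identityʳ _)
  sum-indicator-lookup {x ∷ xs} c (x∉ ∷ xs!) (suc m) = A.trans
    (A.+-cong (*-indicator-≢ _ (ListAll.lookup x∉ (∈-lookup m))) (sum-indicator-lookup (c ∘ suc) xs! m))
    (A.+-identityˡ _)

  module _ {J I′ : Set} (φ : J → I′ → I) where

    -- The functions that vanish on the union of the images of the `φ j`. The module `R s A p j` is
    -- the instance given by the maps `Δ s p i` with `i ≢ j`.
    vanishing : Module A _ _
    vanishing = ⋂ker (functions A I) (λ _ → functions A I′) (λ j → _∘ φ j) (λ j → precompose-homo A (φ j))

    -- The hypotheses say that `xs` enumerates the complement of the images; the disjunction makes
    -- the case distinction constructive. The indicators of `xs` form a basis: evaluation at the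
    -- points of `xs` recovers the coefficients, and the values of `T` there serve as its
    -- coordinates.
    vanishing-rank : ∀ {xs} → Unique xs → (∀ {x} → x ∈ xs → ∀ j y → x ≢ φ j y) →
      (∀ x → x ∈ xs ⊎ ∃ λ j → ∃ λ y → φ j y ≡ x) → HasRank vanishing (length xs)
    vanishing-rank {xs} xs! ∈⇒≢φ ∈-or-φ = b , record
      { linearlyIndependent = λ c Σcb≈0 l → A.trans
          (A.sym (sum-indicator-lookup c xs! l)) (A.trans (A.sym (evaluate c (lookup xs l))) (Σcb≈0 (lookup xs l)))
      ; spanning = λ (T , T∘φ≈0) → (T ∘ lookup xs) , λ x →
          A.trans (expand T T∘φ≈0 x (∈-or-φ x)) (A.sym (evaluate (T ∘ lookup xs) x))
      }
      where
      open Module vanishing using (Carrierᴹ; +ᴹ-commutativeMonoid)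
      open CommutativeMonoidSum +ᴹ-commutativeMonoid using () renaming (sum to sumᴹ)

      b : Vector Carrierᴹ (length xs)
      b l = indicator (lookup xs l) , λ j y → A.reflexive (indicator-≢ (∈⇒≢φ (∈-lookup l) j y))

      sumᴹ-pointwise : ∀ {n} (v : Vector Carrierᴹ n) x → proj₁ (sumᴹ v) x ≈ sum (λ l → proj₁ (v l) x)
      sumᴹ-pointwise {ℕ.zero} v x = A.refl
      sumᴹ-pointwise {suc n}  v x = A.+-congˡ (sumᴹ-pointwise (v ∘ suc) x)

      evaluate : ∀ c x → proj₁ (linearCombination vanishing c b) x ≈ sum (λ l → c l A.* indicator (lookup xs l) x)
      evaluate c = sumᴹ-pointwise (λ l → Module._*ₗ_ vanishing (c l) (b l))

      expand : ∀ T → (∀ j y → T (φ j y) ≈ 0#) → ∀ x → x ∈ xs ⊎ (∃ λ j → ∃ λ y → φ j y ≡ x) →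
        T x ≈ sum (λ l → T (lookup xs l) A.* indicator (lookup xs l) x)
      expand T T∘φ≈0 x (inj₁ x∈) rewrite lookup-index x∈ = A.sym
        (sum-indicator-lookup (T ∘ lookup xs) xs! (index x∈))
      -- On an image point both sides are 0: `T` by assumption, the sum because the point is not in
      -- `xs`.
      expand T T∘φ≈0 x (inj₂ (j , y , refl)) = A.trans (T∘φ≈0 j y)
        (A.sym (sum-indicator-∉ xs (T ∘ lookup xs) (λ φjy∈ → ∈⇒≢φ φjy∈ j y refl)))

-- The rank of the intersection of face kernels

proposition5p4 : ∀ {c ℓ} (A : CommutativeRing c ℓ) {k′ : ℕ} (s : Vec ℕ (suc k′)) → All NonZero s →
    ∀ (p : ℕ) .{{_ : NonZero p}} (j : Fin (suc p)) →
    ∃ λ (r : ℕ) → HasRank (R s A p j) r ×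
    + r ≡ ∑[ t ≤ p ]
    (-1ℤ ^ toℕ t * + (p C toℕ t) * foldr′ _*_ 1ℤ (map (λ nₐ → + suc (M s nₐ p) - + toℕ t) s))
proposition5p4 A s _ p@(suc p-1) j = length covering , rank , count
  where
  Entry : ℕ → Set
  Entry nₐ = Fin (suc (M s nₐ p))

  entries : ∀ nₐ → List (Entry nₐ)
  entries _ = allFin _

  ι : ∀ nₐ → Fin (suc p) → Entry nₐ
  ι nₐ i = i ↑ˡ excess s nₐ

  missing? : ∀ i → Decidable (Misses {P = Entry} Fin._≟_ ι i {s = s})
  missing? i = misses? {P = Entry} Fin._≟_ ι i

  -- `punchIn j` enumerates the `p` values other than `j` without repetition.
  required : List (Fin (suc p))
  required = tabulate (punchIn j)

  covers? : Decidable (λ x → ListAll.All (λ i → ¬ Misses {P = Entry} Fin._≟_ ι i {s = s} x) required)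
  covers? = hitAll? missing? required

  covering : List (I s p)
  covering = filter covers? (tuples entries s)

  covering-≢Δ : ∀ {x} → x ∈ covering → ∀ ((i , _) : ∃ λ i → i ≢ j) y → x ≢ Δ s p i y
  covering-≢Δ x∈ (i , i≢j) y refl = ListAll.lookup (proj₂ (∈-filter⁻ covers? {xs = tuples entries s} x∈))
    -- As `i ≢ j`, the value `i` equals `punchIn j` of its `punchOut` and is therefore required.
    (subst (_∈ required) (Fin.punchIn-punchOut (i≢j ∘ sym)) (∈-tabulate⁺ {f = punchIn j} _))
    (misses-map {P = Entry} Fin._≟_ ι (λ {nₐ} → punchIn (ι nₐ i)) (λ {nₐ} → Fin.punchInᵢ≢i (ι nₐ i)) y)

  covering-or-Δ : ∀ x → x ∈ covering ⊎ ∃ λ ((i , _) : ∃ λ i → i ≢ j) → ∃ λ y → Δ s p i y ≡ x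
  covering-or-Δ x with covers? x
  ... | yes hits = inj₁ (∈-filter⁺ covers? (∈-tuples {P = Entry} {L = entries} ∈-allFin x) hits)
  ... | no ¬hits
    -- Decidability turns the failure to cover into a concrete required `i` that the tuple misses;
    -- `punchOut` then gives the preimage under `Δ s p i` entry by entry.
    with i , i∈ , ¬¬misses ← find (ListAll.¬All⇒Any¬ (λ i → ¬? (missing? i x)) required ¬hits)
    with k , refl ← ∈-tabulate⁻ {f = punchIn j} i∈ = inj₂
    ( (i , Fin.punchInᵢ≢i j k)
    , misses⇒map {P = Entry} Fin._≟_ ι (λ {nₐ} → punchIn (ι nₐ i))
        (λ c c≢i → punchOut (c≢i ∘ sym) , Fin.punchIn-punchOut _)
        x (decidable-stable (missing? i x) ¬¬misses))

  rank : HasRank (R s A p j) (length covering)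
  rank = vanishing-rank A (≡-dec Fin._≟_) (λ (i , _) → Δ s p i)
    (Unique.filter⁺ covers? (tuples-unique {P = Entry} {L = entries} (λ _ → Unique.allFin⁺ _) s))
    covering-≢Δ covering-or-Δ

  size : ℕ → ℤ
  size t = foldr′ _*_ 1ℤ (map (λ nₐ → + suc (M s nₐ p) - + t) s)

  length-missing : ∀ {is} → Unique is →
    + length (filter (missAll? missing? is) (tuples entries s)) ≡ size (length is)
  length-missing {is} is! = trans
    (length-misses {P = Entry} Fin._≟_ ι (λ nₐ → Fin.↑ˡ-injective (excess s nₐ) _ _)
      {L = entries} (λ _ → Unique.allFin⁺ _) ∈-allFin s is!)
    (cong (foldr′ _*_ 1ℤ) (Vec.map-cong
      (λ nₐ → cong (λ n → + n - + length is) (List.length-tabulate {n = suc (M s nₐ p)} id)) s))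

  count : + length covering ≡ alternatingSum p size
  count = trans
    (inclusion–exclusion missing? required (tuples entries s) size
      -- A sublist of `required` has no repetitions, so its length is the number of values avoided.
      (λ js⊆ → length-missing (Unique-resp-⊆ js⊆ (Unique.tabulate⁺ (Fin.punchIn-injective j _ _)))))
    (cong (λ n → alternatingSum n size) (List.length-tabulate (punchIn j)))
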